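{- Let $n\ge 1$ and consider the Zeckendorf game on $n$ starting from the state $\{F_1^n\}$. Every game path that follows the Split-First Strategy has the maximum possible length among all game paths from $\{F_1^n\}$. (More generally, starting from any game state, every game path following the Split-First Strategy has maximal length among all game paths starting from that state.)
   Context: Fibonacci numbers are indexed by $F_1=1$, $F_2=2$, $F_{i+1}=F_i+F_{i-1}$. A game state is a finite multiset of Fibonacci numbers (tracked by index); $\{F_1^n\}$ denotes $n$ copies of $F_1$. The legal moves are: $C_1$: replace $F_1,F_1$ by $F_2$; for $i\ge 2$, $C_i$: replace $F_{i-1},F_i$ by $F_{i+1}$ (a "combining move"); $S_2$: replace $F_2,F_2$ by $F_1,F_3$; for $i\ge 3$, $S_i$: replace $F_i,F_i$ by $F_{i-2},F_{i+1}$ (a "splitting move"). Here $C_1$ ("combine 1") is grouped with the splitting moves, and "combining move" means $C_i$ with $i\ge 2$. The game on $n$ starts at $\{F_1^n\}$; the total sum $n$ is invariant, no legal move exists exactly at the Zeckendorf decomposition of $n$ (the unique representation of $n$ as a sum of $F_i$'s with distinct, pairwise non-consecutive indices), and every sequence of legal moves is finite. A game path from a state $G$ is a sequence of legal moves starting at $G$ and continuing until no legal move is available; its length is its number of moves. A game path follows the Split-First Strategy if at each state along it: whenever some splitting move or $C_1$ is available, the move taken is one of those (any choice); otherwise the move taken is the combining move $C_i$ ($i\ge 2$) with the smallest index $i$ among those available. -}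

module Defs where

open import Data.List using (List; []; _∷_; _++_; map; replicate; sum)
open import Data.List.Relation.Binary.Permutation.Propositional using (_↭_)
open import Data.Nat using (ℕ; suc; _+_; _≤_)
open import Data.Nat.Tactic.RingSolver using (solve-∀)
open import Data.Product using (∃-syntax; _×_)
open import Data.Unit using (⊤)
open import Relation.Binary.PropositionalEquality using (_≡_; refl)
open import Relation.Nullary using (¬_)

-- Indices are shifted by one: k : ℕ stands for the Fibonacci number F_{k+1},
-- so that F₁ = fib 0 = 1 and F₂ = fib 1 = 2.
fib : ℕ → ℕ
fib 0             = 1
fib 1             = 2
fib (suc (suc k)) = fib (suc k) + fib k

-- A finite multiset of (shifted) indices. Lists are only ever compared up to
-- permutation, see _─[_]→_.
State : Set
State = List ℕ

value : State → ℕ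
value G = sum (map fib G)

-- The state {F₁ⁿ}.
initial : ℕ → State
initial n = replicate n 0

-- C₂₊ k is the move C_{k+2}, and S₃₊ k is the move S_{k+3}.
data Move : Set where
  C₁  : Move
  C₂₊ : ℕ → Move
  S₂  : Move
  S₃₊ : ℕ → Move

removed : Move → State
removed C₁      = 0 ∷ 0 ∷ []
removed (C₂₊ k) = k ∷ suc k ∷ []
removed S₂      = 1 ∷ 1 ∷ []
removed (S₃₊ k) = 2 + k ∷ 2 + k ∷ []

added : Move → State
added C₁      = 1 ∷ []
added (C₂₊ k) = 2 + k ∷ []
added S₂      = 0 ∷ 2 ∷ []
added (S₃₊ k) = k ∷ 3 + k ∷ []

value-removed≡value-added : ∀ m → value (removed m) ≡ value (added m)
value-removed≡value-added C₁      = refl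
value-removed≡value-added (C₂₊ k) = lemma (fib k) (fib (suc k))
  where
  lemma : ∀ a b → a + (b + 0) ≡ b + a + 0
  lemma = solve-∀
value-removed≡value-added S₂      = refl
value-removed≡value-added (S₃₊ k) = lemma (fib k) (fib (suc k))
  where
  lemma : ∀ a b → b + a + (b + a + 0) ≡ a + (b + a + b + 0)
  lemma = solve-∀

infix 4 _─[_]→_

_─[_]→_ : State → Move → State → Set
G ─[ m ]→ G′ = ∃[ R ] (G ↭ removed m ++ R × G′ ↭ added m ++ R)

Available : Move → State → Set
Available m G = ∃[ G′ ] G ─[ m ]→ G′

Terminal : State → Set
Terminal G = ∀ m → ¬ Available m G

data Path (G : State) : Set where
  done : Terminal G → Path G
  move : ∀ m {G′} → G ─[ m ]→ G′ → Path G′ → Path G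

length : ∀ {G} → Path G → ℕ
length (done _)     = 0
length (move _ _ p) = suc (length p)

data SplittingOrC₁ : Move → Set where
  isC₁  : SplittingOrC₁ C₁
  isS₂  : SplittingOrC₁ S₂
  isS₃₊ : ∀ {k} → SplittingOrC₁ (S₃₊ k)

-- The strategy's restriction on the move chosen at G; legality of that move
-- is already part of a path.
data SplitFirstChoice (G : State) : Move → Set where
  split   : ∀ {m} → SplittingOrC₁ m → SplitFirstChoice G m
  combine : ∀ {k} →
            (∀ m → SplittingOrC₁ m → ¬ Available m G) →
            (∀ j → Available (C₂₊ j) G → k ≤ j) →
            SplitFirstChoice G (C₂₊ k)

FollowsSplitFirst : ∀ {G} → Path G → Set
FollowsSplitFirst     (done _)     = ⊤
FollowsSplitFirst {G} (move m _ p) = SplitFirstChoice G m × FollowsSplitFirst p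

HasMaximalLength : ∀ {G} → Path G → Set
HasMaximalLength {G} p = (q : Path G) → length q ≤ length p

{-# OPTIONS --safe #-}

-- Write H for the result of a Split-First move on G and G′ for the result of
-- any other move. If the two moves use disjoint terms of G then they commute.
-- Otherwise G′ itself can be reached from H: for instance F_i F_i F_{i+1}
-- becomes F_{i-2} F_{i+1} F_{i+1} under S_i, then F_{i-2} F_{i-1} F_{i+2} under
-- S_{i+1}, then F_i F_{i+2} under C_{i-1}, which is the result of C_{i+1}.
-- Hence a Split-First move costs at most one move of any sequence of moves. The
-- delicate case is a state without repeated terms on which C_j is played in
-- place of C_k with j ≥ k + 2: this may produce a repeated term, which then
-- has to be split before C_k is again the move of the strategy.
module Submission where

open import Defs
open import Data.List using ([]; _∷_; _++_)
open import Data.List.Membership.Propositional using (_∈_; _∉_)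
open import Data.List.Membership.Propositional.Properties using (∈-∃++)
open import Data.List.Relation.Binary.Permutation.Propositional using (_↭_; prep; swap; ↭-refl; ↭-sym; ↭-trans)
open import Data.List.Relation.Binary.Permutation.Propositional.Properties using (drop-∷; shift; shifts; ∈-resp-↭; ++⁺ˡ)
open import Data.List.Relation.Unary.Any using (here; there)
open import Data.Nat using (ℕ; zero; suc; _+_; _≤_; _<_; z≤n; s≤s)
open import Data.Nat.Properties using (_≟_; <-irrefl; <⇒≢; >⇒≢; ≤-refl; ≤-trans; ≮⇒≥; n≤1+n; m+n≤o⇒n≤o; m≤n⇒m≤1+n; m≤n⇒m<n∨m≡n)
open import Data.List.Membership.DecPropositional _≟_ using (_∈?_)
open import Data.Product using (∃-syntax; _×_; _,_)
open import Data.Sum using (inj₁; inj₂)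
open import Function using (_∘_)
open import Relation.Binary.PropositionalEquality using (_≡_; _≢_; refl; sym)
open import Relation.Nullary using (¬_; yes; no; contradiction)

private
  variable
    j k l x y : ℕ
    m : Move
    G H R R′ T : State

-- Multisets up to permutation

∈⇒↭ : x ∈ G → ∃[ R ] G ↭ x ∷ R
∈⇒↭ x∈G with ∈-∃++ x∈G
... | ys , zs , refl = ys ++ zs , shift _ ys zs

↭⇒∈ : G ↭ x ∷ R → x ∈ G
↭⇒∈ p = ∈-resp-↭ (↭-sym p) (here refl)

↭-split : x ≢ y → x ∷ R ↭ y ∷ R′ → ∃[ T ] (R ↭ y ∷ T × R′ ↭ x ∷ T)
↭-split x≢y p with ∈-resp-↭ (↭-sym p) (here refl)
... | here y≡x   = contradiction (sym y≡x) x≢y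
... | there y∈R with ∈⇒↭ y∈R
...   | T , q = T , q , drop-∷ (↭-trans (↭-sym p) (↭-trans (prep _ q) (swap _ _ ↭-refl)))

↭-split₂ : ∀ {x x′ y y′} → x ≢ y → x ≢ y′ → x′ ≢ y → x′ ≢ y′ →
           x ∷ x′ ∷ R ↭ y ∷ y′ ∷ R′ →
           ∃[ T ] (R ↭ y ∷ y′ ∷ T × R′ ↭ x ∷ x′ ∷ T)
↭-split₂ x≢y x≢y′ x′≢y x′≢y′ p
  with _ , p₁ , q₁ ← ↭-split x≢y p
  with _ , p₂ , q₂ ← ↭-split x′≢y p₁
  with _ , p₃ , q₃ ← ↭-split x≢y′ (↭-sym q₁)
  with T , p₄ , q₄ ← ↭-split x′≢y′ (↭-trans (↭-sym q₂) p₃)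
  = T , ↭-trans p₂ (prep _ p₄) , ↭-trans q₃ (prep _ q₄)

NoRepeats : State → Set
NoRepeats G = ∀ {i R} → ¬ (G ↭ i ∷ i ∷ R)

noRepeats-∷ : x ∉ G → NoRepeats G → NoRepeats (x ∷ G)
noRepeats-∷ {x} x∉G nr {i} p with x ≟ i
... | yes refl = x∉G (↭⇒∈ (drop-∷ p))
... | no x≢i with _ , q , r ← ↭-split x≢i p
             with _ , _ , s ← ↭-split (x≢i ∘ sym) r = nr (↭-trans q (prep _ s))

∈-tail : x ≢ y → x ∈ y ∷ G → x ∈ G
∈-tail x≢y (here x≡y)  = contradiction x≡y x≢y
∈-tail x≢y (there x∈G) = x∈G

-- One family for `C₁`, `S₂` and `S₃₊`: each consumes two equal terms, so its overlap with another
-- move is decided by comparing indices.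
splitAt : ℕ → Move
splitAt 0             = C₁
splitAt 1             = S₂
splitAt (suc (suc k)) = S₃₊ k

removed-splitAt : ∀ i → removed (splitAt i) ≡ i ∷ i ∷ []
removed-splitAt 0             = refl
removed-splitAt 1             = refl
removed-splitAt (suc (suc k)) = refl

splitAt-split : ∀ i → SplittingOrC₁ (splitAt i)
splitAt-split 0             = isC₁
splitAt-split 1             = isS₂
splitAt-split (suc (suc k)) = isS₃₊

data SplitView : Move → Set where
  at : ∀ i → SplitView (splitAt i)

splitView : SplittingOrC₁ m → SplitView m
splitView isC₁        = at 0
splitView isS₂        = at 1
splitView (isS₃₊ {k}) = at (2 + k)

data MoveView : Move → Set where
  splitting : ∀ i → MoveView (splitAt i)
  combining : ∀ k → MoveView (C₂₊ k)

moveView : ∀ m → MoveView m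
moveView C₁      = splitting 0
moveView (C₂₊ k) = combining k
moveView S₂      = splitting 1
moveView (S₃₊ k) = splitting (2 + k)

noSplit⇒noRepeats : (∀ m → SplittingOrC₁ m → ¬ Available m G) → NoRepeats G
noSplit⇒noRepeats {G} noSplit {i} {R} p = noSplit (splitAt i) (splitAt-split i) (_ , R , p′ , ↭-refl)
  where
  p′ : G ↭ removed (splitAt i) ++ R
  p′ rewrite removed-splitAt i = p

noRepeats⇒noSplit : NoRepeats G → ∀ m → SplittingOrC₁ m → ¬ Available m G
noRepeats⇒noSplit nr m s (_ , R , p , _) with splitView s
... | at i rewrite removed-splitAt i = nr p

pair-available : k ∈ G → suc k ∈ G → Available (C₂₊ k) G
pair-available k∈G 1+k∈G with R , p ← ∈⇒↭ k∈G
  with T , q ← ∈⇒↭ (∈-tail (>⇒≢ ≤-refl) (∈-resp-↭ p 1+k∈G)) =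
  _ , T , ↭-trans p (prep _ q) , ↭-refl

-- Runs need not end in a terminal state, so the induction on their length
-- does not require the game to terminate.
data Run : State → ℕ → Set where
  stop : Run G 0
  step : ∀ m R → G ↭ removed m ++ R → Run (added m ++ R) l → Run G (suc l)

run-resp-↭ : G ↭ H → Run G l → Run H l
run-resp-↭ p stop           = stop
run-resp-↭ p (step m R q r) = step m R (↭-trans (↭-sym p) q) r

run-pred : Run G (suc l) → Run G l
run-pred (step m R p stop)             = stop
run-pred (step m R p r@(step _ _ _ _)) = step m R p (run-pred r)

path⇒run : (q : Path G) → Run G (length q)
path⇒run (done _)                = stop
path⇒run (move m (R , p , p′) q) = step m R p (run-resp-↭ p′ (path⇒run q))

-- Overlapping and disjoint moves

-- After the split, the result of `C₂₊ i` is one move away if `i` is 0 and two moves away otherwise;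
-- `run-pred` trims the surplus in the second case.
split-dominates-C-above : ∀ i → Run (2 + i ∷ i ∷ R) l →
                          Run (added (splitAt i) ++ suc i ∷ R) (suc l)
split-dominates-C-above 0 r = step S₂ _ ↭-refl (run-resp-↭ (swap _ _ ↭-refl) r)
split-dominates-C-above 1 r = run-pred
  (step (S₃₊ 0) _ (shifts (_ ∷ []) (_ ∷ _ ∷ [])) (step C₁ _ (prep _ (swap _ _ ↭-refl)) (run-resp-↭ (swap _ _ ↭-refl) r)))
split-dominates-C-above (suc (suc k)) r = run-pred
  (step (S₃₊ (suc k)) _ (shifts (_ ∷ []) (_ ∷ _ ∷ []))
    (step (C₂₊ k) _ (shifts (_ ∷ _ ∷ []) (_ ∷ [])) (run-resp-↭ (swap _ _ ↭-refl) r)))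

-- The smaller term produced by the split combines with the leftover `j`: both are 0 if `j` is 0,
-- and otherwise they are consecutive.
split-dominates-C-below : ∀ j → Run (2 + j ∷ suc j ∷ R) l →
                          Run (added (splitAt (suc j)) ++ j ∷ R) (suc l)
split-dominates-C-below 0 r =
  step C₁ _ (prep _ (swap _ _ ↭-refl)) (run-resp-↭ (swap _ _ ↭-refl) r)
split-dominates-C-below (suc k) r =
  step (C₂₊ k) _ (prep _ (swap _ _ ↭-refl)) (run-resp-↭ (swap _ _ ↭-refl) r)

Apart : Move → Move → State → State → Set
Apart m m′ R R′ = ∃[ T ] (R ↭ removed m′ ++ T × R′ ↭ removed m ++ T)

split-split-apart : ∀ {i j} → i ≢ j → removed (splitAt i) ++ R ↭ removed (splitAt j) ++ R′ →
                    Apart (splitAt i) (splitAt j) R R′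
split-split-apart {i = i} {j} i≢j p rewrite removed-splitAt i | removed-splitAt j =
  ↭-split₂ i≢j i≢j i≢j i≢j p

split-C-apart : ∀ {i j} → i ≢ j → i ≢ suc j → removed (splitAt i) ++ R ↭ removed (C₂₊ j) ++ R′ →
                Apart (splitAt i) (C₂₊ j) R R′
split-C-apart {i = i} i≢j i≢1+j p rewrite removed-splitAt i =
  ↭-split₂ i≢j i≢1+j i≢j i≢1+j p

C-C-apart : 2 + k ≤ j → removed (C₂₊ k) ++ R ↭ removed (C₂₊ j) ++ R′ →
            Apart (C₂₊ k) (C₂₊ j) R R′
C-C-apart 2+k≤j = ↭-split₂ (<⇒≢ k<j) (<⇒≢ (m≤n⇒m≤1+n k<j)) (<⇒≢ 2+k≤j) (<⇒≢ (m≤n⇒m≤1+n 2+k≤j))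
  where k<j = ≤-trans (n≤1+n _) 2+k≤j

commute : ∀ m m′ → R ↭ removed m′ ++ T → Run (added m ++ added m′ ++ T) l →
          Run (added m ++ R) (suc l)
commute {T = T} m m′ p r =
  step m′ (added m ++ T) (↭-trans (++⁺ˡ (added m) p) (shifts (added m) (removed m′)))
    (run-resp-↭ (shifts (added m) (added m′)) r)

split-same : ∀ i → removed (splitAt i) ++ R ↭ removed (splitAt i) ++ R′ → R ↭ R′
split-same i p rewrite removed-splitAt i = drop-∷ (drop-∷ p)

split-C-above : ∀ i → removed (splitAt i) ++ R ↭ removed (C₂₊ i) ++ R′ →
                ∃[ T ] (R ↭ suc i ∷ T × R′ ↭ i ∷ T)
split-C-above i p rewrite removed-splitAt i = ↭-split (<⇒≢ ≤-refl) (drop-∷ p)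

split-C-below : ∀ j → removed (splitAt (suc j)) ++ R ↭ removed (C₂₊ j) ++ R′ →
                ∃[ T ] (R ↭ j ∷ T × R′ ↭ suc j ∷ T)
split-C-below j p rewrite removed-splitAt (suc j) =
  ↭-split (>⇒≢ ≤-refl) (drop-∷ (↭-trans p (swap _ _ ↭-refl)))

-- The cost of a Split-First move

mutual
  -- Induction on `l`, comparing `m` with the first move of the run. If the two are disjoint, the
  -- tail of the run is treated by induction, once `m` is again a choice of the strategy.
  splitFirst-loses-≤1 : ∀ l {G m R} → SplitFirstChoice G m → G ↭ removed m ++ R →
                        Run G (suc l) → Run (added m ++ R) l
  splitFirst-loses-≤1 zero    c p r = stop
  splitFirst-loses-≤1 (suc l) (split s) p (step m′ R′ p′ r)
    with splitView s | moveView m′ | ↭-trans (↭-sym p) p′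
  ... | at i | splitting j | q with i ≟ j
  ...   | yes refl = run-resp-↭ (++⁺ˡ (added (splitAt i)) (↭-sym (split-same i q))) r
  ...   | no i≢j with _ , a , b ← split-split-apart i≢j q =
    commute (splitAt i) (splitAt j) a (split-after l (splitAt j) s b r)
  splitFirst-loses-≤1 (suc l) (split s) p (step m′ R′ p′ r)
      | at i | combining j | q with i ≟ j | i ≟ suc j
  ...   | yes refl | _ with _ , a , b ← split-C-above i q =
    run-resp-↭ (++⁺ˡ (added (splitAt i)) (↭-sym a))
      (run-pred (split-dominates-C-above i (run-resp-↭ (prep _ b) r)))
  ...   | no _ | yes refl with _ , a , b ← split-C-below j q =
    run-resp-↭ (++⁺ˡ (added (splitAt i)) (↭-sym a))
      (run-pred (split-dominates-C-below j (run-resp-↭ (prep _ b) r)))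
  ...   | no i≢j | no i≢1+j with _ , a , b ← split-C-apart i≢j i≢1+j q =
    commute (splitAt i) (C₂₊ j) a (split-after l (C₂₊ j) s b r)
  splitFirst-loses-≤1 (suc l) (combine {k} noSplit least) p (step m′ R′ p′ r)
    with moveView m′
  ... | splitting j = contradiction (_ , R′ , p′ , ↭-refl) (noSplit _ (splitAt-split j))
  ... | combining j with ↭-trans (↭-sym p) p′ | m≤n⇒m<n∨m≡n (least j (_ , R′ , p′ , ↭-refl))
  ...   | q | inj₂ refl = run-resp-↭ (prep _ (↭-sym (drop-∷ (drop-∷ q)))) r
  ...   | q | inj₁ k<j with m≤n⇒m<n∨m≡n k<j
  -- The moves share `suc k`. Playing `C₂₊ k` duplicates `2 + k`, and splitting that pair gives the
  -- result of `C₂₊ (suc k)`.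
  ...     | inj₂ refl
    with _ , a , b ← ↭-split (<⇒≢ (n≤1+n _)) (drop-∷ (↭-trans (swap _ _ ↭-refl) q)) =
    run-pred (step (S₃₊ k) _ (prep _ a)
      (run-resp-↭ (↭-trans (prep _ b) (swap _ _ ↭-refl)) r))
  ...     | inj₁ 2+k≤j with T , a , b ← C-C-apart 2+k≤j q =
    commute (C₂₊ k) (C₂₊ j) a
      (combine-after l 2+k≤j
        -- A repetition among the remaining terms, or a further copy of `j` or `suc j`, would be a
        -- repetition in the original state.
        (λ e → nr (↭-trans G↭ (↭-trans (++⁺ˡ (j ∷ suc j ∷ []) e) (shifts (j ∷ suc j ∷ []) (_ ∷ _ ∷ [])))))
        (λ j∈ → let _ , e = ∈⇒↭ j∈ in
          nr (↭-trans G↭ (prep _ (↭-trans (prep _ e) (swap _ _ ↭-refl)))))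
        (λ 1+j∈ → let _ , e = ∈⇒↭ 1+j∈ in
          nr (↭-trans G↭ (↭-trans (++⁺ˡ (j ∷ suc j ∷ []) e) (shifts (j ∷ []) (_ ∷ _ ∷ [])))))
        (λ i<k i∈ 1+i∈ → <-irrefl refl (≤-trans i<k (least _ (pair-available (weaken i∈) (weaken 1+i∈)))))
        (run-resp-↭ (prep _ b) r))
    where
    nr : NoRepeats _
    nr = noSplit⇒noRepeats noSplit
    G↭ : _ ↭ j ∷ suc j ∷ k ∷ suc k ∷ T
    G↭ = ↭-trans p′ (++⁺ˡ (j ∷ suc j ∷ []) b)
    weaken : x ∈ k ∷ suc k ∷ T → x ∈ _
    weaken x∈ = ∈-resp-↭ (↭-sym G↭) (there (there x∈))

  -- A splitting move is allowed by the strategy wherever it is legal, so `m` remains a choice after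
  -- `m′`.
  split-after : ∀ l m′ → SplittingOrC₁ m → R′ ↭ removed m ++ T → Run (added m′ ++ R′) (suc l) →
                Run (added m ++ added m′ ++ T) l
  split-after {m = m} l m′ s p r =
    splitFirst-loses-≤1 l (split s)
      (↭-trans (++⁺ˡ (added m′) p) (shifts (added m′) (removed m))) r

  -- C₂₊ k is the move of the strategy on the state k, k+1, T. The extra term 2 + j
  -- may repeat a term of T; splitting it gives a state of the same shape, with
  -- j + 1 for j.
  combine-after : ∀ l {k j T} → 2 + k ≤ j → NoRepeats (k ∷ suc k ∷ T) →
                  j ∉ k ∷ suc k ∷ T → suc j ∉ k ∷ suc k ∷ T →
                  (∀ {i} → i < k → i ∈ k ∷ suc k ∷ T → suc i ∉ k ∷ suc k ∷ T) →
                  Run (2 + j ∷ k ∷ suc k ∷ T) (suc l) → Run (2 + k ∷ 2 + j ∷ T) l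
  combine-after l {k} {j} {T} 2+k≤j nr j∉ 1+j∉ np r with 2 + j ∈? k ∷ suc k ∷ T
  ... | no 2+j∉ =
    splitFirst-loses-≤1 l
      (combine (noRepeats⇒noSplit (noRepeats-∷ 2+j∉ nr)) least)
      (shifts (2 + j ∷ []) (k ∷ suc k ∷ [])) r
    where
    -- The extra term `2 + j` is too large to belong to a pair `i`, `suc i` with `i < k`.
    least : ∀ i → Available (C₂₊ i) (2 + j ∷ k ∷ suc k ∷ T) → k ≤ i
    least i (_ , _ , p , _) = ≮⇒≥ λ i<k →
      let 1+i≤1+j = m≤n⇒m≤1+n (≤-trans i<k (m+n≤o⇒n≤o 2 2+k≤j)) in
      np i<k
        (∈-tail (<⇒≢ (m≤n⇒m≤1+n 1+i≤1+j)) (↭⇒∈ p))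
        (∈-tail (<⇒≢ (s≤s 1+i≤1+j)) (↭⇒∈ (↭-trans p (swap _ _ ↭-refl))))
  ... | yes (here e) = contradiction e (>⇒≢ (m≤n⇒m≤1+n (s≤s (m+n≤o⇒n≤o 2 2+k≤j))))
  ... | yes (there (here e)) = contradiction e (>⇒≢ (s≤s (s≤s (m+n≤o⇒n≤o 2 2+k≤j))))
  ... | yes (there (there 2+j∈)) with U , e ← ∈⇒↭ 2+j∈ =
    after-split l (splitFirst-loses-≤1 l (split (isS₃₊ {j})) (prep _ T↭) r)
    where
    T↭ : k ∷ suc k ∷ T ↭ 2 + j ∷ k ∷ suc k ∷ U
    T↭ = ↭-trans (++⁺ˡ (k ∷ suc k ∷ []) e) (shifts (k ∷ suc k ∷ []) (2 + j ∷ []))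
    to-front : k ∷ suc k ∷ j ∷ U ↭ j ∷ k ∷ suc k ∷ U
    to-front = shifts (k ∷ suc k ∷ []) (j ∷ [])
    nrU : NoRepeats (k ∷ suc k ∷ U)
    nrU q = nr (↭-trans T↭ (↭-trans (prep _ q) (shifts (2 + j ∷ []) (_ ∷ _ ∷ []))))
    add-2+j : x ∈ k ∷ suc k ∷ U → x ∈ k ∷ suc k ∷ T
    add-2+j x∈ = ∈-resp-↭ (↭-sym T↭) (there x∈)
    drop-j : x ≢ j → x ∈ k ∷ suc k ∷ j ∷ U → x ∈ k ∷ suc k ∷ U
    drop-j x≢j x∈ = ∈-tail x≢j (∈-resp-↭ to-front x∈)
    after-split : ∀ l → Run (j ∷ 3 + j ∷ k ∷ suc k ∷ U) l → Run (2 + k ∷ 2 + j ∷ T) l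
    after-split zero    s = stop
    after-split (suc l) s =
      -- The same split, played from the target state, regains the move given up above. As `l`
      -- drops, the chain of splits ends.
      step (S₃₊ j) (2 + k ∷ U)
        (↭-trans (++⁺ˡ (2 + k ∷ 2 + j ∷ []) e) (shifts (2 + k ∷ []) (2 + j ∷ 2 + j ∷ [])))
        (run-resp-↭
          (↭-trans (shifts (2 + k ∷ 3 + j ∷ []) (j ∷ [])) (prep _ (swap _ _ ↭-refl)))
          (combine-after l (m≤n⇒m≤1+n 2+k≤j)
            -- Now `j ∷ U` replaces `T`. The hypothesis `j∉` keeps the terms distinct, `1+j∉`
            -- becomes the next `j∉`, and `nr` excludes another `2 + j`.
            (λ q → noRepeats-∷ (j∉ ∘ add-2+j) nrU (↭-trans (↭-sym to-front) q))
            (1+j∉ ∘ add-2+j ∘ drop-j (>⇒≢ ≤-refl))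
            (λ x∈ → let _ , q = ∈⇒↭ (drop-j (>⇒≢ (n≤1+n _)) x∈) in nr (↭-trans T↭ (prep _ q)))
            (λ i<k i∈ 1+i∈ →
              let 1+i<j = ≤-trans (s≤s i<k) (≤-trans (n≤1+n _) 2+k≤j) in
              np i<k (add-2+j (drop-j (<⇒≢ (≤-trans (n≤1+n _) 1+i<j)) i∈))
                     (add-2+j (drop-j (<⇒≢ 1+i<j) 1+i∈)))
            (run-resp-↭ (shifts (j ∷ []) (3 + j ∷ k ∷ suc k ∷ [])) s)))

-- Induction on `p`: each strategy move costs the run at most one move, and a terminal state admits
-- only the empty run.
splitFirst-bounds-run : (p : Path G) → FollowsSplitFirst p → Run G l → l ≤ length p
splitFirst-bounds-run p _ stop = z≤n
splitFirst-bounds-run (done t) _ (step m R e _) = contradiction (_ , R , e , ↭-refl) (t m)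
splitFirst-bounds-run (move m (R , e , e′) p) (c , f) r@(step _ _ _ _) =
  s≤s (splitFirst-bounds-run p f (run-resp-↭ (↭-sym e′) (splitFirst-loses-≤1 _ c e r)))

splitFirst-maximal : ∀ G (p : Path G) → FollowsSplitFirst p → HasMaximalLength p
splitFirst-maximal G p f q = splitFirst-bounds-run p f (path⇒run q)

theorem1p1 : (∀ (n : ℕ) → 1 ≤ n → (p : Path (initial n)) → FollowsSplitFirst p → HasMaximalLength p)
    × (∀ (G : State) (p : Path G) → FollowsSplitFirst p → HasMaximalLength p)
theorem1p1 = (λ n _ → splitFirst-maximal (initial n)) , splitFirst-maximal
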